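{- Let $G$ be a graph and $M$ a matching in $G$ such that $(G,M)$ satisfies property $\mathcal{P}$. Then every subgraph $H$ of $G_M$ with at least two vertices contains at least two vertices of degree at most $2$ in $H$.
   Context: All graphs are finite, simple and undirected. A graph is 2-connected if it has at least two vertices, is connected, and has no cut vertex. For a matching $M$ in $G$, $G[M]$ is the subgraph of $G$ induced by the endpoints of edges of $M$, and $G_M$ is the simple graph obtained from $G[M]$ by contracting each edge $xy\in M$ to a vertex $v_{xy}$ and removing parallel edges. $(G,M)$ satisfies property $\mathcal{P}$ if (i) $G_M$ is 2-connected, and (ii) for every edge $ab\in E(G)\setminus M$ with $a,b\in V(G[M])$, there is no cycle in $G-ab$ containing both $a$ and $b$. -}

module Defs where

open import Data.Nat using (ℕ; _≤_; _<_)
open import Data.Bool using (Bool; true; false; if_then_else_)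
open import Data.Fin using (Fin; toℕ)
open import Data.List using (List; []; _∷_; _++_; [_]; length; map; allFin)
open import Data.Nat.ListAction using (sum)
open import Data.List.Membership.Propositional using (_∈_)
open import Data.List.Relation.Unary.Linked using (Linked)
open import Data.List.Relation.Unary.Unique.Propositional using (Unique)
open import Data.Product using (Σ; ∃; _×_; _,_)
open import Data.Sum using (_⊎_)
open import Relation.Binary.PropositionalEquality using (_≡_; _≢_)
open import Relation.Nullary using (¬_)

record Graph (n : ℕ) : Set where
  field
    adj     : Fin n → Fin n → Bool
    adj-sym : ∀ u v → adj u v ≡ adj v u
    adj-irr : ∀ v → adj v v ≡ false
open Graph public

record Matching {n : ℕ} (G : Graph n) : Set where
  field
    medge     : Fin n → Fin n → Bool
    medge-sym : ∀ u v → medge u v ≡ medge v u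
    medge-adj : ∀ u v → medge u v ≡ true → adj G u v ≡ true
    medge-uniq : ∀ u v w → medge u v ≡ true → medge u w ≡ true → v ≡ w
open Matching public

data Reach {n : ℕ} (V : Fin n → Set) (A : Fin n → Fin n → Set) : Fin n → Fin n → Set where
  here : ∀ {u} → V u → Reach V A u u
  step : ∀ {u v w} → V u → A u v → Reach V A v w → Reach V A u w

Connected : {n : ℕ} → (Fin n → Set) → (Fin n → Fin n → Set) → Set
Connected V A = ∀ u v → V u → V v → Reach V A u v

Minus : {n : ℕ} → (Fin n → Set) → Fin n → (Fin n → Set)
Minus V w x = V x × x ≢ w

IsCutVertex : {n : ℕ} → (Fin n → Set) → (Fin n → Fin n → Set) → Fin n → Set
IsCutVertex V A w =
  V w × Σ _ λ u → Σ _ λ v → Minus V w u × Minus V w v × Reach V A u v × ¬ Reach (Minus V w) A u v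

TwoConnected : {n : ℕ} → (Fin n → Set) → (Fin n → Fin n → Set) → Set
TwoConnected V A =
  (Σ _ λ u → Σ _ λ v → V u × V v × u ≢ v)
  × Connected V A
  × (∀ w → ¬ IsCutVertex V A w)

IsCycle : {n : ℕ} → (Fin n → Fin n → Set) → Fin n → List (Fin n) → Set
IsCycle A v vs = Unique (v ∷ vs) × 2 ≤ length vs × Linked A (v ∷ vs ++ [ v ])

module _ {n : ℕ} (G : Graph n) (M : Matching G) where

  E : Fin n → Fin n → Set
  E u v = adj G u v ≡ true

  Covered : Fin n → Set
  Covered v = Σ (Fin n) λ u → medge M v u ≡ true

  -- Vertices of G_M: the contracted vertex v_xy of an M-edge xy is
  -- represented by its endpoint with the smaller index.
  VGM : Fin n → Set
  VGM x = Σ (Fin n) λ y → medge M x y ≡ true × toℕ x < toℕ y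

  EndOf : Fin n → Fin n → Set
  EndOf x x' = x' ≡ x ⊎ medge M x x' ≡ true

  AdjGM : Fin n → Fin n → Set
  AdjGM a b = VGM a × VGM b × a ≢ b ×
    Σ (Fin n) λ a' → Σ (Fin n) λ b' → EndOf a a' × EndOf b b' × E a' b'

  EMinus : Fin n → Fin n → Fin n → Fin n → Set
  EMinus a b u v = E u v × ¬ ((u ≡ a × v ≡ b) ⊎ (u ≡ b × v ≡ a))

  PropertyP : Set
  PropertyP =
    TwoConnected VGM AdjGM ×
    (∀ a b → E a b → medge M a b ≡ false → Covered a → Covered b →
       ¬ (Σ (Fin n) λ v → Σ (List (Fin n)) λ vs →
            IsCycle (EMinus a b) v vs × a ∈ (v ∷ vs) × b ∈ (v ∷ vs)))

  record SubgraphGM : Set where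
    field
      hv     : Fin n → Bool
      he     : Fin n → Fin n → Bool
      hv-sub : ∀ x → hv x ≡ true → VGM x
      he-sub : ∀ x y → he x y ≡ true → AdjGM x y × hv x ≡ true × hv y ≡ true
      he-sym : ∀ x y → he x y ≡ he y x

  open SubgraphGM public

  degH : SubgraphGM → Fin n → ℕ
  degH H x = sum (map (λ y → if he H x y then 1 else 0) (allFin n))

{-# OPTIONS --safe #-}
module Submission where

-- Undo the contraction over H: K consists of the edges of G lying over edges of H
-- together with the matching edges of its vertices.  By Menger's theorem for two
-- paths, property (ii) says that for every non-matching edge xz of K some vertex t
-- separates x from z in K − xz.
--
-- Suppose all vertices of H but one have degree at least 3, and take a minimal
-- nonempty set I of such vertices attached to the rest of H at no more than two
-- vertices ("poles") that are connected outside I.  Separating the ends of an edge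
-- xz meeting I would yield a smaller such set, unless x (or z) has no neighbour
-- but its mate and the other end.  Let such an edge be an arrow leaving the vertex
-- of G_M that contains x.  Every vertex emits at most one arrow, every pole receives
-- one and every vertex of I receives two, which is impossible by counting.

open import Defs
open import Data.Bool using (Bool; true; false; if_then_else_)
open import Data.Bool.Properties using (¬-not) renaming (_≟_ to _≟ᵇ_)
open import Data.Empty using (⊥; ⊥-elim)
open import Data.Fin using (Fin; toℕ; _≟_)
open import Data.Fin.Properties using (any?; punchOut-injective; <⇒notInjective; toℕ-injective)
open import Data.Fin.Subset using (Subset; _∈_; _∉_; _⊂_; _⊃_; _∪_; ⁅_⁆)
open import Data.Fin.Subset.Induction using (Acc; acc; ⊃-wellFounded; ⊂-wellFounded)
open import Data.Fin.Subset.Properties using (_∈?_; x∈p∪q⁺; x∈p∪q⁻; x∈⁅x⁆; x∈⁅y⁆⇒x≡y)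
open import Data.List using (List; []; _∷_; _++_; [_]; length; reverse; reverseAcc; filter; map; allFin)
import Data.List.Membership.DecPropositional as DecMembership
open import Data.List.Membership.Propositional using () renaming (_∈_ to _∈ₗ_; _∉_ to _∉ₗ_)
open import Data.List.Membership.Propositional.Properties using (∈-++⁺ʳ)
open import Data.List.Properties using (++-assoc; unfold-reverse)
open import Data.List.Relation.Binary.Disjoint.Propositional using (Disjoint)
open import Data.List.Relation.Binary.Permutation.Propositional using (↭⇒↭ₛ; ↭-sym)
open import Data.List.Relation.Binary.Permutation.Propositional.Properties using (↭-reverse)
import Data.List.Relation.Binary.Permutation.Setoid.Properties as PermutationSetoid
open import Data.List.Relation.Unary.All using (All; []; _∷_)
open import Data.List.Relation.Unary.All.Properties using (All¬⇒¬Any; ¬Any⇒All¬; all-filter)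
open import Data.List.Relation.Unary.AllPairs using ([]; _∷_)
open import Data.List.Relation.Unary.Any using (here; there)
open import Data.List.Relation.Unary.Any.Properties using (reverse⁻)
import Data.List.Relation.Unary.Linked as Linked
open import Data.List.Relation.Unary.Linked using (Linked; [-]; _∷_)
open import Data.List.Relation.Unary.Unique.Propositional using (Unique)
import Data.List.Relation.Unary.Unique.Propositional.Properties as Unique
open import Data.Nat using (ℕ; suc; _≤_; z≤n; s≤s; _<_)
open import Data.Nat.ListAction using (sum)
open import Data.Nat.Properties using (≤-refl; _<?_; _≤?_; <-asym; ≮⇒≥; ≤-antisym; ≰⇒>)
open import Data.Product using (Σ; ∃; _×_; _,_; proj₁; proj₂)
open import Data.Sum using (_⊎_; inj₁; inj₂; [_,_]′; swap; map₂)
open import Data.Unit using (⊤; tt)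
open import Data.Vec using (tabulate)
open import Data.Vec.Properties using (lookup∘tabulate; []=⇒lookup; lookup⇒[]=)
open import Function using (_∘_; id)
open import Relation.Binary.PropositionalEquality using (_≡_; _≢_; refl; sym; trans; cong; subst; setoid; subst₂)
open import Relation.Nullary using (¬_; Dec; yes; no; does; contradiction)
open import Relation.Nullary.Decidable using (_×-dec_; _⊎-dec_; ¬?; dec-true; decidable-stable)
open import Relation.Unary using (Decidable)

-- Injections of a finite set and subsets given by decidable predicates.

private
  variable
    n : ℕ

-- If `k` were missed, punching it out of the codomain would inject a finite set into a smaller one.
injective⇒surjective : (f : Fin n → Fin n) → (∀ {i j} → f i ≡ f j → i ≡ j) → ∀ k → ∃ λ i → f i ≡ k
injective⇒surjective {suc m} f inj k with any? (λ i → f i ≟ k)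
... | yes hit = hit
... | no ¬hit = ⊥-elim (<⇒notInjective (≤-refl {suc m})
      (λ {i} {j} → inj ∘ punchOut-injective (k≢f i) (k≢f j)))
  where
  k≢f : ∀ i → k ≢ f i
  k≢f i eq = ¬hit (i , sym eq)

⊎-reverse : {X Y Z : Set} → X ⊎ Y ⊎ Z → Z ⊎ Y ⊎ X
⊎-reverse = [ inj₂ ∘ inj₂ , [ inj₂ ∘ inj₁ , inj₁ ]′ ]′

module _ {P : Fin n → Set} (P? : Decidable P) where

  ⟪_⟫ : Subset n
  ⟪_⟫ = tabulate (does ∘ P?)

  ∈⟪⟫⁺ : ∀ {p} → P p → p ∈ ⟪_⟫
  ∈⟪⟫⁺ {p} Pp = lookup⇒[]= p _ (trans (lookup∘tabulate _ p) (dec-true (P? p) Pp))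

  ∈⟪⟫⁻ : ∀ {p} → p ∈ ⟪_⟫ → P p
  ∈⟪⟫⁻ {p} p∈ with P? p | trans (sym (lookup∘tabulate (does ∘ P?) p)) ([]=⇒lookup p∈)
  ... | yes Pp | _ = Pp

-- Walks, components and paths.

module _ {n : ℕ} where

  private
    variable
      u v w : Fin n
      V W : Fin n → Set
      A B : Fin n → Fin n → Set

  reach-map : (∀ {p} → V p → W p) → (∀ {p q} → A p q → B p q) → Reach V A u w → Reach W B u w
  reach-map f g (here Vu)     = here (f Vu)
  reach-map f g (step Vu e r) = step (f Vu) (g e) (reach-map f g r)

  reach-weaken : (∀ {p} → V p → W p) → Reach V A u w → Reach W A u w
  reach-weaken f = reach-map f id

  reach-trans : Reach V A u v → Reach V A v w → Reach V A u w
  reach-trans (here _)      s = s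
  reach-trans (step Vu e r) s = step Vu e (reach-trans r s)

  reach-source : Reach V A u w → V u
  reach-source (here Vu)     = Vu
  reach-source (step Vu _ _) = Vu

  reach-target : Reach V A u w → V w
  reach-target (here Vu)    = Vu
  reach-target (step _ _ r) = reach-target r

  reach-sym : (∀ {p q} → A p q → A q p) → Reach V A u w → Reach V A w u
  reach-sym s (here Vu)     = here Vu
  reach-sym s (step Vu e r) =
    reach-trans (reach-sym s r) (step (reach-source r) (s e) (here Vu))

  reach-invariant : {Q : Fin n → Set} → (∀ {p q} → Q p → V p → V q → A p q → Q q) →
                    Q u → Reach V A u w → Q w
  reach-invariant inv Qu (here _)      = Qu
  reach-invariant inv Qu (step Vu e r) = reach-invariant inv (inv Qu Vu (reach-source r) e) r

  -- The walk is stopped at its first vertex in `P`. This later trims the link between two poles so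
  -- that it touches the fibre of each at one vertex only.
  reach-firstHit : {P : Fin n → Set} → Decidable P → Reach V A u w → P w →
                   ∃ λ w₁ → P w₁ × Reach (λ p → V p × (P p → p ≡ w₁)) A u w₁
  reach-firstHit P? (here Vu) Pw = _ , Pw , here (Vu , λ _ → refl)
  reach-firstHit {u = u} P? (step Vu e r) Pw with P? u
  ... | yes Pu = u , Pu , here (Vu , λ _ → refl)
  ... | no ¬Pu = let w₁ , Pw₁ , r₁ = reach-firstHit P? r Pw in
                 w₁ , Pw₁ , step (Vu , ⊥-elim ∘ ¬Pu) e r₁

  -- `U` grows by the heads of edges leaving it, which ends because the vertex set is finite. The
  -- walks are kept inside `U` so that later arguments can confine them to one side of a separation.
  component : {B : Fin n → Fin n → Set} → (∀ p q → Dec (B p q)) → (y : Fin n) →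
              Σ (Subset n) λ U → y ∈ U × (∀ {p} → p ∈ U → Reach (_∈ U) B y p) ×
                (∀ {p q} → p ∈ U → B p q → q ∈ U)
  component {B} B? y = grow ⁅ y ⁆ (⊃-wellFounded _) (x∈⁅x⁆ y) start
    where
    start : ∀ {p} → p ∈ ⁅ y ⁆ → Reach (_∈ ⁅ y ⁆) B y p
    start p∈ rewrite x∈⁅y⁆⇒x≡y y p∈ = here (x∈⁅x⁆ y)
    grow : (U : Subset n) → Acc _⊃_ U → y ∈ U → (∀ {p} → p ∈ U → Reach (_∈ U) B y p) →
           Σ (Subset n) λ U → y ∈ U × (∀ {p} → p ∈ U → Reach (_∈ U) B y p) ×
             (∀ {p q} → p ∈ U → B p q → q ∈ U)
    grow U (acc rec) y∈ reach
      with any? (λ p → any? (λ q → (p ∈? U) ×-dec (B? p q ×-dec ¬? (q ∈? U))))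
    ... | no ¬new = U , y∈ , reach , λ {p} {q} p∈ b →
            decidable-stable (q ∈? U) (λ q∉ → ¬new (p , q , p∈ , b , q∉))
    ... | yes (p , q , p∈ , b , q∉) = grow U′ (rec (old , q , q∈ , q∉)) (old y∈) reach′
      where
      U′ = U ∪ ⁅ q ⁆
      old : ∀ {r} → r ∈ U → r ∈ U′
      old = x∈p∪q⁺ ∘ inj₁
      q∈ : q ∈ U′
      q∈ = x∈p∪q⁺ (inj₂ (x∈⁅x⁆ q))
      reach′ : ∀ {r} → r ∈ U′ → Reach (_∈ U′) B y r
      reach′ r∈ with x∈p∪q⁻ U ⁅ q ⁆ r∈
      ... | inj₁ r∈U = reach-weaken old (reach r∈U)
      ... | inj₂ r∈q rewrite x∈⁅y⁆⇒x≡y q r∈q =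
            reach-trans (reach-weaken old (reach p∈)) (step (old p∈) b (here q∈))

  -- The list of a path contains its source but not its target.
  data Path (A : Fin n → Fin n → Set) (w : Fin n) : Fin n → List (Fin n) → Set where
    nil  : Path A w w []
    cons : ∀ {u v ps} → A u v → Path A w v ps → Path A w u (u ∷ ps)

  path-suffix : ∀ {ps} → Path A w v ps → u ∈ₗ ps → ∃ λ qs →
                Path A w u qs × (Unique ps → Unique qs) × (∀ {q} → q ∈ₗ qs → q ∈ₗ ps)
  path-suffix (cons e P) (here refl) = _ , cons e P , id , id
  path-suffix (cons e P) (there u∈)  =
    let qs , Q , uniq , sub = path-suffix P u∈
    in  qs , Q , (λ { (_ ∷ un) → uniq un }) , there ∘ sub

  path⇒reach : ∀ {ps} → Path A w u ps → Reach (λ _ → ⊤) A u w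
  path⇒reach nil        = here tt
  path⇒reach (cons e P) = step tt e (path⇒reach P)

  path-linked : ∀ {ps ys} → Path A w u ps → Linked A (w ∷ ys) → Linked A (ps ++ w ∷ ys)
  path-linked nil                   l = l
  path-linked (cons e nil)          l = e ∷ l
  path-linked (cons e P@(cons _ _)) l = e ∷ path-linked P l

  -- The accumulator of `reverseAcc` holds the part already walked, so following the path forwards
  -- builds the reversed list, with symmetry turning each edge round.
  path-linkedʳ : (∀ {p q} → A p q → A q p) → ∀ {ps ys} → Path A w u ps → Linked A (u ∷ ys) →
                 Linked A (w ∷ reverseAcc ys ps)
  path-linkedʳ s nil        l = l
  path-linkedʳ s (cons e P) l = path-linkedʳ s P (s e ∷ l)

-- Pairs of internally disjoint paths.

unique-reverse : {xs : List (Fin n)} → Unique xs → Unique (reverse xs)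
unique-reverse {n} {xs} =
  PermutationSetoid.Unique-resp-↭ (setoid (Fin n)) (↭⇒↭ₛ (↭-sym (↭-reverse xs)))

-- The case as = bs = [], where both paths are the single edge vx, is allowed.
record TwoPaths {n : ℕ} (A : Fin n → Fin n → Set) (x v : Fin n) : Set where
  field
    {as bs} : List (Fin n)
    pathᵃ   : Path A x v (v ∷ as)
    pathᵇ   : Path A x v (v ∷ bs)
    uniqueᵃ : Unique (v ∷ as)
    uniqueᵇ : Unique (v ∷ bs)
    apart   : Disjoint as bs
    x∉as    : x ∉ₗ as
    x∉bs    : x ∉ₗ bs
    x≢v     : x ≢ v

module _ {n : ℕ} {A : Fin n → Fin n → Set} where

  open DecMembership (_≟_ {n}) using () renaming (_∈?_ to _∈ₗ?_)

  unique-∉ : ∀ {v} {as : List (Fin n)} → Unique (v ∷ as) → v ∉ₗ as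
  unique-∉ (v≢ ∷ _) = All¬⇒¬Any v≢

  unique-tail : ∀ {v} {as : List (Fin n)} → Unique (v ∷ as) → Unique as
  unique-tail (_ ∷ un) = un

  module _ {x v : Fin n} (T : TwoPaths A x v) where
    open TwoPaths T

    -- From u, follow the walk to x until it first meets one of the two paths,
    -- then that path; the other path is left untouched.
    detour : ∀ {u} → Reach (_≢ v) A u x → ∃ λ ps →
             Path A x u ps × Unique ps × x ∉ₗ ps × (Disjoint ps (v ∷ as) ⊎ Disjoint ps (v ∷ bs))
    detour (here _) = [] , nil , [] , (λ ()) , inj₁ λ ()
    detour {u} (step u≢v e r) with u ≟ x | u ∈ₗ? as | u ∈ₗ? bs
    ... | yes refl | _ | _ = [] , nil , [] , (λ ()) , inj₁ λ ()
    ... | no _ | yes u∈as | _ with cons _ P ← pathᵃ =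
          let qs , Q , uniq , sub = path-suffix P u∈as
          in  qs , Q , uniq (unique-tail uniqueᵃ) , x∉as ∘ sub ,
              inj₂ λ { (q∈ , here refl) → unique-∉ uniqueᵃ (sub q∈)
                     ; (q∈ , there q∈bs) → apart (sub q∈ , q∈bs) }
    ... | no _ | no _ | yes u∈bs with cons _ P ← pathᵇ =
          let qs , Q , uniq , sub = path-suffix P u∈bs
          in  qs , Q , uniq (unique-tail uniqueᵇ) , x∉bs ∘ sub ,
              inj₁ λ { (q∈ , here refl) → unique-∉ uniqueᵇ (sub q∈)
                     ; (q∈ , there q∈as) → apart (q∈as , sub q∈) }
    ... | no u≢x | no u∉as | no u∉bs with detour r
    ... | ps , P , un , x∉ps , dis with u ∈ₗ? ps
    ... | yes u∈ps =
          let qs , Q , uniq , sub = path-suffix P u∈ps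
          in  qs , Q , uniq un , x∉ps ∘ sub , shrink sub dis
      where
      shrink : ∀ {qs} → (∀ {q} → q ∈ₗ qs → q ∈ₗ ps) →
               Disjoint ps (v ∷ as) ⊎ Disjoint ps (v ∷ bs) →
               Disjoint qs (v ∷ as) ⊎ Disjoint qs (v ∷ bs)
      shrink sub (inj₁ d) = inj₁ λ { (q∈ , q∈′) → d (sub q∈ , q∈′) }
      shrink sub (inj₂ d) = inj₂ λ { (q∈ , q∈′) → d (sub q∈ , q∈′) }
    ... | no u∉ps = u ∷ ps , cons e P , ¬Any⇒All¬ ps u∉ps ∷ un ,
          (λ { (here x≡u) → u≢x (sym x≡u) ; (there x∈) → x∉ps x∈ }) , enlarge dis
      where
      enlarge : Disjoint ps (v ∷ as) ⊎ Disjoint ps (v ∷ bs) →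
                Disjoint (u ∷ ps) (v ∷ as) ⊎ Disjoint (u ∷ ps) (v ∷ bs)
      enlarge (inj₁ d) = inj₁ λ { (here refl , here u≡v) → u≢v u≡v
                                ; (here refl , there u∈) → u∉as u∈
                                ; (there q∈ , q∈′) → d (q∈ , q∈′) }
      enlarge (inj₂ d) = inj₂ λ { (here refl , here u≡v) → u≢v u≡v
                                ; (here refl , there u∈) → u∉bs u∈
                                ; (there q∈ , q∈′) → d (q∈ , q∈′) }

    -- The detour from `y` misses one of the two old paths entirely. That path, prolonged by the
    -- edge `yv`, and the detour itself are the new pair.
    twoPaths-extend : ∀ {y} → A y v → x ≢ y → Reach (_≢ v) A y x → TwoPaths A x y
    twoPaths-extend {y} e x≢y r with detour r
    ... | _ , nil , _ = contradiction refl x≢y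
    ... | _ , P@(cons _ _) , un , x∉ps , inj₁ dis = record
      { pathᵃ = cons e pathᵃ ; pathᵇ = P
      ; uniqueᵃ = ¬Any⇒All¬ _ (λ y∈ → dis (here refl , y∈)) ∷ uniqueᵃ ; uniqueᵇ = un
      ; apart = λ { (q∈ , q∈′) → dis (there q∈′ , q∈) }
      ; x∉as = λ { (here x≡v) → x≢v x≡v ; (there x∈) → x∉as x∈ } ; x∉bs = x∉ps ∘ there
      ; x≢v = x≢y }
    ... | _ , P@(cons _ _) , un , x∉ps , inj₂ dis = record
      { pathᵃ = cons e pathᵇ ; pathᵇ = P
      ; uniqueᵃ = ¬Any⇒All¬ _ (λ y∈ → dis (here refl , y∈)) ∷ uniqueᵇ ; uniqueᵇ = un
      ; apart = λ { (q∈ , q∈′) → dis (there q∈′ , q∈) }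
      ; x∉as = λ { (here x≡v) → x≢v x≡v ; (there x∈) → x∉bs x∈ } ; x∉bs = x∉ps ∘ there
      ; x≢v = x≢y }

    -- The cycle runs along one path and back along the other. Non-adjacency of `v` and `x` forces
    -- `as` to be nonempty, which rules out the degenerate pair and gives a third vertex.
    twoPaths⇒cycle : (∀ {p q} → A p q → A q p) → ¬ A v x →
                     Σ (List (Fin n)) λ vs → IsCycle A v vs × x ∈ₗ v ∷ vs
    twoPaths⇒cycle s ¬e =
      as ++ x ∷ reverse bs , (unique , long as pathᵃ , linked) , there (∈-++⁺ʳ as (here refl))
      where
      long : ∀ cs → Path A x v (v ∷ cs) → 2 ≤ length (cs ++ x ∷ reverse bs)
      long []           (cons e nil) = contradiction e ¬e
      long (_ ∷ [])     _ = s≤s (s≤s z≤n)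
      long (_ ∷ _ ∷ _)  _ = s≤s (s≤s z≤n)
      unique : Unique (v ∷ as ++ x ∷ reverse bs)
      unique = Unique.++⁺ uniqueᵃ
        (¬Any⇒All¬ _ (x∉bs ∘ reverse⁻) ∷ unique-reverse (unique-tail uniqueᵇ))
        λ { (here refl , here v≡x) → x≢v (sym v≡x)
          ; (here refl , there v∈) → unique-∉ uniqueᵇ (reverse⁻ v∈)
          ; (there q∈ , here refl) → x∉as q∈
          ; (there q∈ , there q∈′) → apart (q∈ , reverse⁻ q∈′) }
      linked : Linked A (v ∷ (as ++ x ∷ reverse bs) ++ [ v ])
      linked = subst (λ l → Linked A (v ∷ l))
        (trans (cong (λ l → as ++ x ∷ l) (unfold-reverse v bs))
               (sym (++-assoc as (x ∷ reverse bs) [ v ])))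
        (path-linked pathᵃ (path-linkedʳ s pathᵇ [-]))

-- Paired graphs and Menger's theorem for two paths.

-- A graph K with a set of disjoint edges p (mate p); the fibres of π are the
-- vertices obtained by contracting these edges.
record PairedGraph (n : ℕ) : Set₁ where
  field
    K        : Fin n → Fin n → Set
    K?       : ∀ p q → Dec (K p q)
    K-sym    : ∀ {p q} → K p q → K q p
    K-irr    : ∀ {p} → ¬ K p p
    mate     : Fin n → Fin n
    π        : Fin n → Fin n
    mate-inv : ∀ p → mate (mate p) ≡ p
    π-mate   : ∀ p → π (mate p) ≡ π p
    π-fibre  : ∀ {p q} → π p ≡ π q → q ≡ p ⊎ q ≡ mate p
    K-mate   : ∀ {p q} → K p q → K p (mate p)

module Separations {n : ℕ} (Γ : PairedGraph n) where
  open PairedGraph Γ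

  Without : Fin n → Fin n → Fin n → Fin n → Set
  Without x z p q = K p q × ¬ ((p ≡ x × q ≡ z) ⊎ (p ≡ z × q ≡ x))

  -- The vertex `t` cuts `K` minus the edge `xz` into two sides. The walks `connL` and `connR` exist
  -- so that `x` and `t`, or `z` and `t`, can become the linked poles of a smaller cap lying in `L`
  -- or in `R`.
  record Separation (x z : Fin n) : Set where
    field
      L R     : Subset n
      t       : Fin n
      x∈L     : x ∈ L
      z∈R     : z ∈ R
      L∩R     : ∀ {p} → p ∈ L → p ∉ R
      t∉L     : t ∉ L
      t∉R     : t ∉ R
      cover   : ∀ p → p ∈ L ⊎ p ≡ t ⊎ p ∈ R
      noCross : ∀ {p q} → p ∈ L → q ∈ R → K p q → p ≡ x × q ≡ z
      connL   : Reach (λ p → p ∈ L → p ≡ x) K x t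
      connR   : Reach (λ p → p ∈ R → p ≡ z) K z t

  separation-sym : ∀ {x z} → Separation x z → Separation z x
  separation-sym S = record
    { L = R ; R = L ; t = t ; x∈L = z∈R ; z∈R = x∈L ; L∩R = λ r l → L∩R l r ; t∉L = t∉R ; t∉R = t∉L
    ; cover = λ p → ⊎-reverse (cover p)
    ; noCross = λ p∈ q∈ e → let q≡ , p≡ = noCross q∈ p∈ (K-sym e) in p≡ , q≡
    ; connL = connR ; connR = connL }
    where
    open Separation S

  module _ {x z : Fin n} (Kxz : K x z) (πx≢πz : π x ≢ π z) where

    private
      K⁻ : Fin n → Fin n → Set
      K⁻ = Without x z

    removed? : ∀ p q → Dec ((p ≡ x × q ≡ z) ⊎ (p ≡ z × q ≡ x))
    removed? p q = ((p ≟ x) ×-dec (q ≟ z)) ⊎-dec ((p ≟ z) ×-dec (q ≟ x))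

    without? : ∀ p q → Dec (K⁻ p q)
    without? p q = K? p q ×-dec ¬? (removed? p q)

    without-sym : ∀ {p q} → K⁻ p q → K⁻ q p
    without-sym (e , ne) = K-sym e , λ { (inj₁ (a , b)) → ne (inj₂ (b , a)) ; (inj₂ (a , b)) → ne (inj₁ (b , a)) }

    separate : (L R : Subset n) (t : Fin n) → x ∈ L → z ∈ R → (∀ {p} → p ∈ L → p ∉ R) → t ∉ L → t ∉ R →
               (∀ p → p ∈ L ⊎ p ≡ t ⊎ p ∈ R) → (∀ {p q} → p ∈ L → q ∈ R → ¬ K⁻ p q) →
               Reach (λ p → p ∈ L → p ≡ x) K x t → Reach (λ p → p ∈ R → p ≡ z) K z t → Separation x z
    separate L R t x∈L z∈R L∩R t∉L t∉R cover ¬K⁻ connL connR = record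
      { L = L ; R = R ; t = t ; x∈L = x∈L ; z∈R = z∈R ; L∩R = L∩R ; t∉L = t∉L ; t∉R = t∉R ; cover = cover
      ; noCross = noCross ; connL = connL ; connR = connR }
      where
      noCross : ∀ {p q} → p ∈ L → q ∈ R → K p q → p ≡ x × q ≡ z
      noCross {p} {q} p∈ q∈ e with removed? p q
      ... | yes (inj₁ eqs)        = eqs
      ... | yes (inj₂ (refl , _)) = contradiction z∈R (L∩R p∈)
      ... | no ne                 = contradiction (e , ne) (¬K⁻ p∈ q∈)

    outside? : (U : Subset n) (w : Fin n) → Decidable (λ p → p ∉ U × p ≢ w)
    outside? U w p = ¬? (p ∈? U) ×-dec ¬? (p ≟ w)

    cover-outside : (U : Subset n) (w p : Fin n) → p ∈ U ⊎ p ≡ w ⊎ p ∈ ⟪ outside? U w ⟫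
    cover-outside U w p with p ∈? U | p ≟ w
    ... | yes p∈ | _      = inj₁ p∈
    ... | no _   | yes p≡ = inj₂ (inj₁ p≡)
    ... | no p∉  | no p≢  = inj₂ (inj₂ (∈⟪⟫⁺ (outside? U w) (p∉ , p≢)))

    -- w cuts p off from x: the component U of p in the graph without w misses x.
    record Trapped (p : Fin n) : Set where
      field
        {w y}  : Fin n
        U      : Subset n
        paths  : TwoPaths K⁻ x w
        K⁻wy    : K⁻ w y
        p∈U    : p ∈ U
        x∉U    : x ∉ U
        w∉U    : w ∉ U
        reach  : ∀ {q} → q ∈ U → Reach (_∈ U) K⁻ y q
        closed : ∀ {q r} → q ∈ U → K⁻ q r → r ∈ U ⊎ r ≡ w

    -- The cut vertex `w` becomes `t` and `U` becomes the side of `z`. For `connL`, cross from `x`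
    -- to `z`, go back inside `U` to `y` and step to `w`. For `connR`, cross from `z` to `x` and
    -- follow one of the two paths to `w`: edges enter `U` from outside only at `w`, so this walk
    -- stays out of `U`.
    trapped⇒separation : Trapped z → Separation x z
    trapped⇒separation T = separate ⟪ outside? U w ⟫ U w
      (∈⟪⟫⁺ (outside? U w) (x∉U , TwoPaths.x≢v paths)) p∈U L∩U
      (λ w∈ → proj₂ (∈⟪⟫⁻ (outside? U w) w∈) refl) w∉U (λ p → ⊎-reverse (cover-outside U w p)) noEdge
      (step (λ _ → refl) Kxz
        (reach-trans (reach-map (λ p∈ p∈L → contradiction p∈ (L∩U p∈L)) proj₁ (reach-sym without-sym (reach p∈U)))
          (step (λ y∈L → contradiction y∈U (L∩U y∈L)) (K-sym (proj₁ K⁻wy))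
            (here λ w∈ → contradiction refl (proj₂ (∈⟪⟫⁻ (outside? U w) w∈))))))
      (step (λ _ → refl) (K-sym Kxz)
        (reach-map (λ p∉ p∈ → contradiction p∈ p∉) proj₁
          (avoid x∉U (reach-sym without-sym (path⇒reach (TwoPaths.pathᵃ paths))))))
      where
      open Trapped T
      L∩U : ∀ {p} → p ∈ ⟪ outside? U w ⟫ → p ∉ U
      L∩U = proj₁ ∘ ∈⟪⟫⁻ (outside? U w)
      y∈U : y ∈ U
      y∈U = reach-source (reach p∈U)
      noEdge : ∀ {p q} → p ∈ ⟪ outside? U w ⟫ → q ∈ U → ¬ K⁻ p q
      noEdge p∈ q∈ a with closed q∈ (without-sym a)
      ... | inj₁ p∈U = L∩U p∈ p∈U
      ... | inj₂ p≡w = proj₂ (∈⟪⟫⁻ (outside? U w) p∈) p≡w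
      avoid : ∀ {u} → u ∉ U → Reach (λ _ → ⊤) K⁻ u w → Reach (_∉ U) K⁻ u w
      avoid u∉ (here _) = here u∉
      avoid {u} u∉ (step {v = v} _ a r) with u ≟ w
      ... | yes refl = here u∉
      ... | no u≢w   = step u∉ a (avoid v∉ r)
        where
        v∉ : v ∉ U
        v∉ v∈ with closed v∈ (without-sym a)
        ... | inj₁ u∈  = u∉ u∈
        ... | inj₂ u≡w = u≢w u≡w

    Progress : Fin n → Set
    Progress p = p ≡ x ⊎ TwoPaths K⁻ x p ⊎ Trapped p

    -- The induction step of Menger's theorem along a walk from `x`. With `p` deleted, either `q`
    -- still reaches `x`, and the two paths extend, or the component of `q` misses `x`, and `p` is
    -- the cut vertex. A trapped walk can leave `U` only through `w`, for which two paths are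
    -- already known.
    advance : ∀ {p q} → Progress p → K⁻ p q → Progress q
    advance {q = q} _ a with q ≟ x
    advance _ a | yes q≡x = inj₁ q≡x
    advance (inj₁ refl) a | no q≢x = inj₂ (inj₁ (record
      { pathᵃ = cons (without-sym a) nil ; pathᵇ = cons (without-sym a) nil
      ; uniqueᵃ = [] ∷ [] ; uniqueᵇ = [] ∷ [] ; apart = λ () ; x∉as = λ () ; x∉bs = λ () ; x≢v = q≢x ∘ sym }))
    advance {p} {q} (inj₂ (inj₁ T)) a | no q≢x
      -- Forbidding `p` as the head of a step is enough to delete it, because the start `q` differs
      -- from `p`.
      with component (λ r s → without? r s ×-dec ¬? (s ≟ p)) q
    ... | U , q∈U , reach , closed = found
      where
      q≢p : q ≢ p
      q≢p refl = K-irr (proj₁ a)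
      p∉U : p ∉ U
      p∉U p∈ = reach-invariant {Q = _≢ p} (λ _ _ _ → proj₂) q≢p (reach p∈) refl
      found : Progress q
      found with x ∈? U
      ... | yes x∈U = inj₂ (inj₁ (twoPaths-extend T (without-sym a) (q≢x ∘ sym)
              (reach-map (λ { r∈ refl → p∉U r∈ }) proj₁ (reach x∈U))))
      ... | no x∉U = inj₂ (inj₂ (record
        { U = U ; paths = T ; K⁻wy = a ; p∈U = q∈U ; x∉U = x∉U ; w∉U = p∉U
        ; reach = reach-map id proj₁ ∘ reach ; closed = closed′ }))
        where
        closed′ : ∀ {r s} → r ∈ U → K⁻ r s → s ∈ U ⊎ s ≡ p
        closed′ {s = s} r∈ b with s ≟ p
        ... | yes s≡p = inj₂ s≡p
        ... | no s≢p  = inj₁ (closed r∈ (b , s≢p))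
    advance (inj₂ (inj₂ T)) a | no _ with Trapped.closed T (Trapped.p∈U T) a
    ... | inj₁ q∈U  = inj₂ (inj₂ (record
            { U = U ; paths = paths ; K⁻wy = K⁻wy ; p∈U = q∈U ; x∉U = x∉U ; w∉U = w∉U ; reach = reach ; closed = closed }))
      where open Trapped T
    ... | inj₂ refl = inj₂ (inj₁ (Trapped.paths T))

    x≢z : x ≢ z
    x≢z refl = πx≢πz refl

    -- When `xz` is a bridge there is no natural cut vertex, and `mate z` is taken as `t`: it lies
    -- on the side of `z`, and its edge to `z` supplies both connecting walks.
    bridge⇒separation : (U : Subset n) → x ∈ U → z ∉ U → (∀ {p q} → p ∈ U → K⁻ p q → q ∈ U) → Separation x z
    bridge⇒separation U x∈U z∉U closed = separate U ⟪ outside? U m ⟫ m x∈U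
      (∈⟪⟫⁺ (outside? U m) (z∉U , z≢m)) (λ p∈ p∈′ → proj₁ (∈⟪⟫⁻ (outside? U m) p∈′) p∈) m∉U m∉R
      (cover-outside U m) (λ p∈ q∈ a → proj₁ (∈⟪⟫⁻ (outside? U m) q∈) (closed p∈ a))
      (step (λ _ → refl) Kxz (step (λ z∈ → contradiction z∈ z∉U) Kzm (here λ m∈ → contradiction m∈ m∉U)))
      (step (λ _ → refl) Kzm (here λ m∈ → contradiction m∈ m∉R))
      where
      m = mate z
      Kzm : K z m
      Kzm = K-mate (K-sym Kxz)
      z≢m : z ≢ m
      z≢m z≡m = K-irr (subst (K z) (sym z≡m) Kzm)
      m∉U : m ∉ U
      m∉U m∈ = z∉U (closed m∈ (K-sym Kzm , λ
        { (inj₁ (m≡x , _)) → πx≢πz (trans (cong π (sym m≡x)) (π-mate z))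
        ; (inj₂ (_ , z≡x)) → x≢z (sym z≡x) }))
      m∉R : m ∉ ⟪ outside? U m ⟫
      m∉R m∈ = proj₂ (∈⟪⟫⁻ (outside? U m) m∈) refl

    twoPaths⊎separation : TwoPaths K⁻ x z ⊎ Separation x z
    twoPaths⊎separation with component without? x
    ... | U , x∈U , reach , closed with z ∈? U
    ... | no z∉U  = inj₂ (bridge⇒separation U x∈U z∉U closed)
    ... | yes z∈U with reach-invariant {Q = Progress} (λ s _ _ → advance s) (inj₁ refl) (reach z∈U)
    ... | inj₁ z≡x        = contradiction (sym z≡x) x≢z
    ... | inj₂ (inj₁ P)   = inj₁ P
    ... | inj₂ (inj₂ T)   = inj₂ (trapped⇒separation T)

    cycle⊎separation : (Σ (List (Fin n)) λ vs → IsCycle K⁻ z vs × x ∈ₗ z ∷ vs) ⊎ Separation x z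
    cycle⊎separation with twoPaths⊎separation
    ... | inj₁ P = inj₁ (twoPaths⇒cycle P without-sym λ a → proj₂ a (inj₂ (refl , refl)))
    ... | inj₂ S = inj₂ S

-- Caps in the contracted graph.

module Caps {n : ℕ} (Γ : PairedGraph n) where
  open PairedGraph Γ
  open Separations Γ

  Adjacent : Fin n → Fin n → Set
  Adjacent g h = g ≢ h × Σ (Fin n) λ p → Σ (Fin n) λ q → π p ≡ g × π q ≡ h × K p q

  ThreeNeighbours : Fin n → Set
  ThreeNeighbours h = Σ (Fin n) λ g₁ → Σ (Fin n) λ g₂ → Σ (Fin n) λ g₃ →
    Adjacent h g₁ × Adjacent h g₂ × Adjacent h g₃ × g₁ ≢ g₂ × g₁ ≢ g₃ × g₂ ≢ g₃

  neighbour-avoiding : ∀ {h} → ThreeNeighbours h → ∀ c d → ∃ λ g → Adjacent h g × g ≢ c × g ≢ d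
  neighbour-avoiding (g₁ , g₂ , g₃ , e₁ , e₂ , e₃ , g₁≢g₂ , g₁≢g₃ , g₂≢g₃) c d
    with g₁ ≟ c | g₁ ≟ d | g₂ ≟ c | g₂ ≟ d
  ... | no ≢c    | no ≢d    | _        | _        = g₁ , e₁ , ≢c , ≢d
  ... | _        | _        | no ≢c    | no ≢d    = g₂ , e₂ , ≢c , ≢d
  ... | yes refl | _        | yes refl | _        = contradiction refl g₁≢g₂
  ... | _        | yes refl | _        | yes refl = contradiction refl g₁≢g₂
  ... | yes refl | _        | _        | yes refl = g₃ , e₃ , g₁≢g₃ ∘ sym , g₂≢g₃ ∘ sym
  ... | _        | yes refl | yes refl | _        = g₃ , e₃ , g₂≢g₃ ∘ sym , g₁≢g₃ ∘ sym

  -- A union I of fibres attached to the rest of the graph only at the fibres of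
  -- a and b, which are linked to each other outside I.
  record Cap (I : Subset n) (a b : Fin n) : Set where
    field
      nonempty  : ∃ λ p → p ∈ I
      saturated : ∀ {p} → p ∈ I → mate p ∈ I
      degree    : ∀ {p} → p ∈ I → ThreeNeighbours (π p)
      closed    : ∀ {p q} → p ∈ I → K p q → q ∈ I ⊎ π q ≡ π a ⊎ π q ≡ π b
      a∉I       : a ∉ I
      b∉I       : b ∉ I
      linked    : Reach (_∉ I) K a b

    fibre : ∀ {p q} → p ∈ I → π p ≡ π q → q ∈ I
    fibre p∈ eq with π-fibre eq
    ... | inj₁ refl = p∈
    ... | inj₂ refl = saturated p∈

    -- A neighbour of the fibre of `p` provides an edge at `p` or at its mate, and either one brings
    -- the matching edge into `K`.
    mate-edge : ∀ {p} → p ∈ I → K p (mate p)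
    mate-edge {p} p∈ with neighbour-avoiding (degree p∈) p p
    ... | _ , (_ , p₁ , _ , πp₁ , _ , e) , _ with π-fibre (sym πp₁)
    ... | inj₁ refl = K-mate e
    ... | inj₂ refl = K-sym (subst (K (mate p)) (mate-inv p) (K-mate e))

  cap-sym : ∀ {I a b} → Cap I a b → Cap I b a
  cap-sym C = record
    { nonempty = nonempty ; saturated = saturated ; degree = degree
    ; closed = λ p∈ e → map₂ swap (closed p∈ e) ; a∉I = b∉I ; b∉I = a∉I ; linked = reach-sym K-sym linked }
    where
    open Cap C

  -- Minimal caps: the case of one pole and the neighbours of a pole.

  module MinimalCap (sep : ∀ {x z} → K x z → π x ≢ π z → Separation x z)
                    (I : Subset n) (minimal : ∀ {I′ a b} → I′ ⊂ I → ¬ Cap I′ a b) where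

    -- The fibre of an interior vertex p may serve as a new attachment.
    no-shrink : ∀ {a b p c} → Cap I a b → p ∈ I →
                (∀ {r s} → r ∈ I → π r ≢ π p → K r s → s ∈ I ⊎ π s ≡ π c) →
                (c ∈ I → π c ≡ π p) → Reach (λ q → q ∈ I → π q ≡ π p) K c p → ⊥
    no-shrink {a} {b} {p} {c} C p∈ closed′ c∈⇒ conn = minimal (proj₁ ∘ ⁻ , p , p∈ , λ p∈′ → proj₂ (⁻ p∈′) refl) (record
      { nonempty = nonempty′
      ; saturated = λ {q} q∈′ → ⁺ (saturated (proj₁ (⁻ q∈′)) , λ eq → proj₂ (⁻ q∈′) (trans (sym (π-mate q)) eq))
      ; degree = degree ∘ proj₁ ∘ ⁻
      ; closed = closed″
      ; a∉I = λ c∈′ → proj₂ (⁻ c∈′) (c∈⇒ (proj₁ (⁻ c∈′)))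
      ; b∉I = λ p∈′ → proj₂ (⁻ p∈′) refl
      ; linked = reach-weaken (λ f q∈′ → proj₂ (⁻ q∈′) (f (proj₁ (⁻ q∈′)))) conn })
      where
      open Cap C
      I′? : Decidable (λ q → q ∈ I × π q ≢ π p)
      I′? q = (q ∈? I) ×-dec ¬? (π q ≟ π p)
      ⁺ : ∀ {q} → q ∈ I × π q ≢ π p → q ∈ ⟪ I′? ⟫
      ⁺ = ∈⟪⟫⁺ I′?
      ⁻ : ∀ {q} → q ∈ ⟪ I′? ⟫ → q ∈ I × π q ≢ π p
      ⁻ = ∈⟪⟫⁻ I′?
      nonempty′ : ∃ λ q → q ∈ ⟪ I′? ⟫
      -- Of three neighbouring fibres at most two are poles, so one of them remains in the smaller
      -- cap.
      nonempty′ with neighbour-avoiding (degree p∈) (π a) (π b)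
      ... | g , (πp≢g , p₁ , q₁ , πp₁ , refl , e) , g≢a , g≢b with closed (fibre p∈ (sym πp₁)) e
      ... | inj₁ q₁∈       = q₁ , ⁺ (q₁∈ , πp≢g ∘ sym)
      ... | inj₂ (inj₁ eq) = contradiction eq g≢a
      ... | inj₂ (inj₂ eq) = contradiction eq g≢b
      closed″ : ∀ {r s} → r ∈ ⟪ I′? ⟫ → K r s → s ∈ ⟪ I′? ⟫ ⊎ π s ≡ π c ⊎ π s ≡ π p
      closed″ {s = s} r∈′ e with ⁻ r∈′
      ... | r∈ , πr≢ with closed′ r∈ πr≢ e | π s ≟ π p
      ... | _       | yes eq = inj₂ (inj₂ eq)
      ... | inj₁ s∈ | no ne  = inj₁ (⁺ (s∈ , ne))
      ... | inj₂ eq | no _   = inj₂ (inj₁ eq)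

    -- If an edge `pq` joins `I` to the pole, removing the fibre of `p` leaves a smaller cap with
    -- poles `q` and `p`, linked by that edge. If there is no such edge, any fibre of `I` can be
    -- removed and serve as the only pole of what remains.
    no-cap-one-pole : ∀ {a} → ¬ Cap I a a
    no-cap-one-pole {a} C with any? (λ p → any? (λ q → (p ∈? I) ×-dec (K? p q ×-dec (π q ≟ π a))))
    ... | yes (p , q , p∈ , e , πq≡πa) = no-shrink C p∈ closed′ (λ q∈ → contradiction q∈ q∉)
            (step (λ q∈ → contradiction q∈ q∉) (K-sym e) (here λ _ → refl))
      where
      open Cap C
      q∉ : q ∉ I
      q∉ q∈ = a∉I (fibre q∈ πq≡πa)
      closed′ : ∀ {r s} → r ∈ I → π r ≢ π p → K r s → s ∈ I ⊎ π s ≡ π q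
      closed′ r∈ _ e′ with closed r∈ e′
      ... | inj₁ s∈         = inj₁ s∈
      ... | inj₂ (inj₁ eq)  = inj₂ (trans eq (sym πq≡πa))
      ... | inj₂ (inj₂ eq)  = inj₂ (trans eq (sym πq≡πa))
    ... | no none = let p , p∈ = nonempty in no-shrink C p∈ (λ r∈ _ → closed′ r∈) (λ _ → refl) (here λ _ → refl)
      where
      open Cap C
      closed′ : ∀ {r s t} → r ∈ I → K r s → s ∈ I ⊎ π s ≡ π t
      closed′ r∈ e with closed r∈ e
      ... | inj₁ s∈        = inj₁ s∈
      ... | inj₂ (inj₁ eq) = contradiction (_ , _ , r∈ , e , eq) none
      ... | inj₂ (inj₂ eq) = contradiction (_ , _ , r∈ , e , eq) none

    -- A fibre attached to I by a single neighbouring fibre could be replaced by that neighbour.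
    pole-two-neighbours : ∀ {a b} → Cap I a b →
      Σ (Fin n) λ r₁ → Σ (Fin n) λ s₁ → Σ (Fin n) λ r₂ → Σ (Fin n) λ s₂ →
      (r₁ ∈ I × K r₁ s₁ × π s₁ ≡ π a) × (r₂ ∈ I × K r₂ s₂ × π s₂ ≡ π a) × π r₁ ≢ π r₂
    pole-two-neighbours {a} {b} C with any? (λ p → any? (λ q → (p ∈? I) ×-dec (K? p q ×-dec (π q ≟ π a))))
    -- Without an edge to the fibre of `a`, the vertex `b` alone can play both poles.
    ... | no none = ⊥-elim (no-cap-one-pole {b} (record
            { nonempty = nonempty ; saturated = saturated ; degree = degree ; closed = closed′
            ; a∉I = b∉I ; b∉I = b∉I ; linked = here b∉I }))
      where
      open Cap C
      closed′ : ∀ {p q} → p ∈ I → K p q → q ∈ I ⊎ π q ≡ π b ⊎ π q ≡ π b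
      closed′ p∈ e with closed p∈ e
      ... | inj₁ q∈        = inj₁ q∈
      ... | inj₂ (inj₁ eq) = contradiction (_ , _ , p∈ , e , eq) none
      ... | inj₂ (inj₂ eq) = inj₂ (inj₁ eq)
    ... | yes (p , q , p∈ , e , πq≡πa)
      with any? (λ r → any? (λ s → (r ∈? I) ×-dec (K? r s ×-dec ((π s ≟ π a) ×-dec ¬? (π p ≟ π r)))))
    ... | yes (r , s , r∈ , e′ , πs≡πa , ne) = p , q , r , s , (p∈ , e , πq≡πa) , (r∈ , e′ , πs≡πa) , ne
    ... | no none = ⊥-elim (no-shrink C p∈ closed′ (λ b∈ → contradiction b∈ b∉I)
            (reach-trans (reach-sym K-sym (reach-weaken (λ q∉ q∈ → contradiction q∈ q∉) q⇝b))
              (step (λ q∈ → contradiction q∈ q∉) (K-sym e) (here λ _ → refl))))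
      where
      open Cap C
      q∉ : q ∉ I
      q∉ q∈ = a∉I (fibre q∈ πq≡πa)
      q⇝b : Reach (_∉ I) K q b
      q⇝b with π-fibre πq≡πa
      ... | inj₁ refl = linked
      ... | inj₂ refl = step q∉ (K-mate (K-sym e)) linked
      closed′ : ∀ {r s} → r ∈ I → π r ≢ π p → K r s → s ∈ I ⊎ π s ≡ π b
      closed′ r∈ πr≢ e′ with closed r∈ e′
      ... | inj₁ s∈        = inj₁ s∈
      ... | inj₂ (inj₁ eq) = contradiction (_ , _ , r∈ , e′ , eq , πr≢ ∘ sym) none
      ... | inj₂ (inj₂ eq) = inj₂ eq

    -- Two distinct poles: separations of edges meeting the cap.

    module TwoPoles {a b : Fin n} (C : Cap I a b) (πa≢πb : π a ≢ π b)
      -- The link singles out one end, `a` or `b`, of each polar fibre. It meets these fibres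
      -- nowhere else, so it cannot pass through `mate a` or `mate b`.
      (link : Reach (λ p → p ∉ I × (π p ≡ π a → p ≡ a) × (π p ≡ π b → p ≡ b)) K a b) where
      open Cap C

      Pole : Fin n → Set
      Pole q = π q ≡ π a ⊎ π q ≡ π b

      Inside : Fin n → Set
      Inside q = q ∈ I ⊎ Pole q

      pole∉I : ∀ {q} → Pole q → q ∉ I
      pole∉I (inj₁ eq) q∈ = a∉I (fibre q∈ eq)
      pole∉I (inj₂ eq) q∈ = b∉I (fibre q∈ eq)

      -- Excluding `a` and `b` leaves one possible tail in each polar fibre, so that a pole emits at
      -- most one arrow.
      Private : Fin n → Fin n → Set
      Private x z = (∀ {q} → Inside q → K x q → q ≡ mate x ⊎ q ≡ z) × x ≢ a × x ≢ b

      -- Only the side of `x` is studied; the side of `z` is the same for `separation-sym S`.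
      module Side {x z : Fin n} (S : Separation x z) (Kxz : K x z) (πx≢πz : π x ≢ π z)
                  (interior : x ∈ I ⊎ z ∈ I) where
        open Separation S

        mate-x∉R : mate x ∉ R
        mate-x∉R m∈ with noCross x∈L m∈ (K-mate Kxz)
        ... | _ , m≡z = πx≢πz (trans (sym (π-mate x)) (cong π m≡z))

        -- The would-be smaller cap is the part of `I` in `L` outside the fibres of `x` and `c`,
        -- with `x` and `c` as poles: `key` shows that it is closed and `conn` links its poles.
        -- Minimality of `I` makes it empty.
        module NewPole {c : Fin n}
          (key : ∀ {q} → Inside q → q ∉ R → (q ∈ I × q ∈ L) ⊎ π q ≡ π c)
          (conn : Reach (λ p → p ∈ I → p ∈ L → p ≡ x) K x c) where

          no-new : ∀ {q} → q ∈ I → q ∈ L → π q ≢ π x → π q ≢ π c → ⊥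
          no-new {q} q∈I q∈L πq≢πx πq≢πc = minimal (proj₁ ∘ ⁻ , strict interior) (record
            { nonempty = q , ⁺ (q∈I , q∈L , πq≢πx , πq≢πc)
            ; saturated = saturated′ ; degree = degree ∘ proj₁ ∘ ⁻ ; closed = closed′
            ; a∉I = λ x∈ → x∉ (⁻ x∈) refl ; b∉I = λ c∈ → proj₂ (proj₂ (proj₂ (⁻ c∈))) refl
            ; linked = reach-weaken (λ f p∈ → x∉ (⁻ p∈) (f (proj₁ (⁻ p∈)) (proj₁ (proj₂ (⁻ p∈))))) conn })
            where
            New : Fin n → Set
            New p = p ∈ I × p ∈ L × π p ≢ π x × π p ≢ π c
            New? : Decidable New
            New? p = (p ∈? I) ×-dec ((p ∈? L) ×-dec (¬? (π p ≟ π x) ×-dec ¬? (π p ≟ π c)))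
            ⁺ : ∀ {p} → New p → p ∈ ⟪ New? ⟫
            ⁺ = ∈⟪⟫⁺ New?
            ⁻ : ∀ {p} → p ∈ ⟪ New? ⟫ → New p
            ⁻ = ∈⟪⟫⁻ New?
            x∉ : ∀ {p} → New p → p ≢ x
            x∉ (_ , _ , ne , _) refl = ne refl
            strict : x ∈ I ⊎ z ∈ I → ∃ λ p → p ∈ I × p ∉ ⟪ New? ⟫
            strict (inj₁ x∈) = x , x∈ , λ x∈′ → x∉ (⁻ x∈′) refl
            strict (inj₂ z∈) = z , z∈ , λ z∈′ → L∩R (proj₁ (proj₂ (⁻ z∈′))) z∈R
            saturated′ : ∀ {p} → p ∈ ⟪ New? ⟫ → mate p ∈ ⟪ New? ⟫
            saturated′ {p} p∈′ with ⁻ p∈′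
            ... | new@(p∈ , p∈L , ≢x , ≢c)
              with key (inj₁ (saturated p∈)) (λ m∈R → x∉ new (proj₁ (noCross p∈L m∈R (mate-edge p∈))))
            ... | inj₁ (m∈I , m∈L) = ⁺ (m∈I , m∈L , ≢x ∘ trans (sym (π-mate p)) , ≢c ∘ trans (sym (π-mate p)))
            ... | inj₂ eq          = contradiction (trans (sym (π-mate p)) eq) ≢c
            closed′ : ∀ {p r} → p ∈ ⟪ New? ⟫ → K p r → r ∈ ⟪ New? ⟫ ⊎ π r ≡ π x ⊎ π r ≡ π c
            closed′ {p} {r} p∈′ e with ⁻ p∈′
            ... | new@(p∈ , p∈L , _)
              with key (closed p∈ e) (λ r∈R → x∉ new (proj₁ (noCross p∈L r∈R e))) | π r ≟ π x | π r ≟ π c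
            ... | _                | yes eq | _      = inj₂ (inj₁ eq)
            ... | _                | no _   | yes eq = inj₂ (inj₂ eq)
            ... | inj₁ (r∈I , r∈L) | no ≢x  | no ≢c  = inj₁ (⁺ (r∈I , r∈L , ≢x , ≢c))
            ... | inj₂ eq          | no _   | no ≢c  = contradiction eq ≢c

          -- The fibre of `x` has a neighbour other than the fibres of `z` and `c`. The edge to it
          -- cannot cross into `R`, since it would end at `z`, so the neighbour would lie in the
          -- empty candidate cap.
          no-new-pole : x ∈ I → π x ≢ π c → ⊥
          no-new-pole x∈I πx≢πc with neighbour-avoiding (degree x∈I) (π z) (π c)
          ... | g , (πx≢g , x₁ , q₁ , πx₁ , refl , e) , g≢z , g≢c
            with key (inj₁ (fibre x∈I (sym πx₁))) x₁∉R
            where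
            x₁∉R : x₁ ∉ R
            x₁∉R x₁∈ with π-fibre (sym πx₁)
            ... | inj₁ refl = L∩R x∈L x₁∈
            ... | inj₂ refl = mate-x∉R x₁∈
          ... | inj₂ eq = πx≢πc (trans (sym πx₁) eq)
          ... | inj₁ (x₁∈I , x₁∈L)
            with key (closed x₁∈I e) (λ q₁∈R → g≢z (cong π (proj₂ (noCross x₁∈L q₁∈R e))))
          ... | inj₁ (q₁∈I , q₁∈L) = no-new q₁∈I q₁∈L (πx≢g ∘ sym) g≢c
          ... | inj₂ eq            = g≢c eq

        -- If x were c, the link would stay in L and bring the other pole there.
        not-linked-pole : ∀ {c d} → π c ≢ π d → Pole d → c ∉ I → π x ≡ π t →
          Reach (λ p → p ∉ I × (π p ≡ π c → p ≡ c)) K c d →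
          (∀ {q} → Pole q → q ∈ L → π q ≡ π t) → x ≢ c
        not-linked-pole {d = d} πx≢πd pole-d x∉I πx≡πt r poles refl =
          πx≢πd (trans πx≡πt (sym (poles pole-d (reach-invariant stay x∈L r))))
          where
          z∈I : z ∈ I
          z∈I = [ (λ x∈I → contradiction x∈I x∉I) , id ]′ interior
          stay : ∀ {p q} → p ∈ L → p ∉ I × (π p ≡ π x → p ≡ x) → q ∉ I × (π q ≡ π x → q ≡ x) → K p q → q ∈ L
          stay {q = q} p∈L _ (q∉I , q≡x) e with cover q
          ... | inj₁ q∈L         = q∈L
          ... | inj₂ (inj₁ refl) = contradiction (subst (_∈ L) (sym (q≡x (sym πx≡πt))) x∈L) t∉L
          ... | inj₂ (inj₂ q∈R)  = contradiction (subst (_∈ I) (sym (proj₂ (noCross p∈L q∈R e))) z∈I) q∉I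

        free-side-key : (∀ {q} → Pole q → q ∈ L → π q ≡ π t) →
                        ∀ {q} → Inside q → q ∉ R → (q ∈ I × q ∈ L) ⊎ π q ≡ π t
        free-side-key poles {q} i q∉R with cover q
        free-side-key poles (inj₁ q∈I)  _   | inj₁ q∈L         = inj₁ (q∈I , q∈L)
        free-side-key poles (inj₂ pole) _   | inj₁ q∈L         = inj₂ (poles pole q∈L)
        free-side-key poles _           _   | inj₂ (inj₁ refl) = inj₂ refl
        free-side-key poles _           q∉R | inj₂ (inj₂ q∈R)  = contradiction q∈R q∉R

        -- Here `t` serves as the new pole. If `x` and `t` lie in different fibres, `x` is interior
        -- and `no-new-pole` applies. Otherwise `t` is `mate x`, and a further inside neighbour of
        -- `x` would lie in the empty candidate cap.
        private-of-free-side : Inside x → (∀ {q} → Pole q → q ∈ L → π q ≡ π t) → Private x z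
        private-of-free-side x-inside poles with π x ≟ π t
        ... | no πx≢πt = ⊥-elim (no-new-pole (x∈I x-inside) πx≢πt)
          where
          x∈I : Inside x → x ∈ I
          x∈I (inj₁ x∈)  = x∈
          x∈I (inj₂ pole) = contradiction (poles pole x∈L) πx≢πt
          open NewPole {t} (free-side-key poles) (reach-weaken (λ f _ → f) connL)
        ... | yes πx≡πt = only , not-linked-pole πa≢πb (inj₂ refl) a∉I πx≡πt
                (reach-weaken (λ { (p∉ , f , _) → p∉ , f }) link) poles
              , not-linked-pole (πa≢πb ∘ sym) (inj₁ refl) b∉I πx≡πt
                (reach-sym K-sym (reach-weaken (λ { (p∉ , _ , f) → p∉ , f }) link)) poles
          where
          open NewPole {t} (free-side-key poles) (reach-weaken (λ f _ → f) connL)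
          only : ∀ {q} → Inside q → K x q → q ≡ mate x ⊎ q ≡ z
          only {q} i e with q ≟ mate x | q ≟ z
          ... | yes eq | _      = inj₁ eq
          ... | no _   | yes eq = inj₂ eq
          ... | no ≢m  | no ≢z with free-side-key poles i (λ q∈R → ≢z (proj₂ (noCross x∈L q∈R e)))
          ... | inj₁ (q∈I , q∈L) = ⊥-elim (no-new q∈I q∈L πq≢πx (πq≢πx ∘ λ eq → trans eq (sym πx≡πt)))
            where
            πq≢πx : π q ≢ π x
            πq≢πx eq with π-fibre (sym eq)
            ... | inj₁ refl = K-irr e
            ... | inj₂ q≡m  = ≢m q≡m
          ... | inj₂ eq with π-fibre (trans πx≡πt (sym eq))
          ... | inj₁ refl = contradiction e K-irr
          ... | inj₂ q≡m  = contradiction q≡m ≢m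

        -- Suppose `x` were interior. The walk from `c` to `d` avoids `I`, so it cannot leave `L` by
        -- the edge `xz` and must pass through `t`. Joined to `connL` it links `x` with `c`, which
        -- makes `c` a new pole in a fibre other than that of `x`.
        no-crossing : ∀ {c d} → (∀ {q} → Pole q → π q ≡ π c ⊎ π q ≡ π d) → c ∉ I →
                      Reach (_∉ I) K c d → π c ≢ π t → c ∈ L → (∀ {q} → π q ≡ π d → q ∈ R) → x ∉ I
        no-crossing {c} {d} poles c∉I r πc≢πt c∈L d⊆R x∈I =
          no-new-pole x∈I λ πx≡πc → c∉I (fibre x∈I πx≡πc)
          where
          to-t : ∀ {u} → u ∈ L → Reach (_∉ I) K u d → Reach (_∉ I) K u t
          to-t u∈L (here _) = contradiction (d⊆R refl) (L∩R u∈L)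
          to-t u∈L (step {v = v} u∉I e r) with cover v
          ... | inj₁ v∈L         = step u∉I e (to-t v∈L r)
          ... | inj₂ (inj₁ refl) = step u∉I e (here (reach-source r))
          ... | inj₂ (inj₂ v∈R)  = contradiction (subst (_∈ I) (sym (proj₁ (noCross u∈L v∈R e))) x∈I) u∉I
          c⇝t : Reach (_∉ I) K c t
          c⇝t = to-t c∈L r
          key : ∀ {q} → Inside q → q ∉ R → (q ∈ I × q ∈ L) ⊎ π q ≡ π c
          key (inj₂ pole) q∉R with poles pole
          ... | inj₁ eq = inj₂ eq
          ... | inj₂ eq = contradiction (d⊆R eq) q∉R
          key {q} (inj₁ q∈I) q∉R with cover q
          ... | inj₁ q∈L         = inj₁ (q∈I , q∈L)
          ... | inj₂ (inj₁ refl) = contradiction q∈I (reach-target c⇝t)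
          ... | inj₂ (inj₂ q∈R)  = contradiction q∈R q∉R
          open NewPole {c} key (reach-trans (reach-weaken (λ f _ → f) connL)
            (reach-weaken (λ p∉ p∈ → contradiction p∈ p∉) (reach-sym K-sym c⇝t)))

        -- A fibre split between `L` and `R` would have its matching edge crossing, but the only
        -- crossing edge is `xz`, whose ends lie in different fibres.
        fibre-side : ∀ {p q} → K p q → π p ≡ π t ⊎ (∀ {r} → π r ≡ π p → r ∈ L) ⊎ (∀ {r} → π r ≡ π p → r ∈ R)
        fibre-side {p} e with π p ≟ π t
        ... | yes eq = inj₁ eq
        ... | no ne with cover p | cover (mate p)
        ... | inj₂ (inj₁ refl) | _ = contradiction refl ne
        ... | _ | inj₂ (inj₁ eq) = contradiction (trans (sym (π-mate p)) (cong π eq)) ne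
        ... | inj₁ p∈L | inj₁ m∈L = inj₂ (inj₁ λ eq → both (π-fibre (sym eq)))
          where
          both : ∀ {r} → r ≡ p ⊎ r ≡ mate p → r ∈ L
          both (inj₁ refl) = p∈L
          both (inj₂ refl) = m∈L
        ... | inj₂ (inj₂ p∈R) | inj₂ (inj₂ m∈R) = inj₂ (inj₂ λ eq → both (π-fibre (sym eq)))
          where
          both : ∀ {r} → r ≡ p ⊎ r ≡ mate p → r ∈ R
          both (inj₁ refl) = p∈R
          both (inj₂ refl) = m∈R
        ... | inj₁ p∈L | inj₂ (inj₂ m∈R) = let p≡x , m≡z = noCross p∈L m∈R (K-mate e) in
              contradiction (trans (cong π (sym p≡x)) (trans (sym (π-mate p)) (cong π m≡z))) πx≢πz
        ... | inj₂ (inj₂ p∈R) | inj₁ m∈L = let m≡x , p≡z = noCross m∈L p∈R (K-sym (K-mate e)) in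
              contradiction (trans (cong π (sym m≡x)) (trans (π-mate p) (cong π p≡z))) πx≢πz

      -- The position of the polar fibres decides. If neither lies in `L`, the side of `x` is free;
      -- if neither lies in `R`, the side of `z` is. If the separation splits them, `no-crossing` is
      -- applied at whichever end of the edge is interior.
      edge-private : ∀ {x z} → Inside x → Inside z → K x z → π x ≢ π z → x ∈ I ⊎ z ∈ I → Private x z ⊎ Private z x
      edge-private {x} {z} x-in z-in e πx≢πz interior =
        -- The poles lie in different fibres, so the link has a first edge at each end; this is the
        -- edge that `fibre-side` needs.
        decide (X.fibre-side (proj₂ (first-edge πa≢πb link)))
               (X.fibre-side (proj₂ (first-edge (πa≢πb ∘ sym) (reach-sym K-sym link)))) interior
        where
        S = sep e πx≢πz
        open Separation S
        module X = Side S e πx≢πz interior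
        module Z = Side (separation-sym S) (K-sym e) (πx≢πz ∘ sym) (swap interior)
        first-edge : ∀ {V u w} → π u ≢ π w → Reach V K u w → ∃ λ v → K u v
        first-edge ne (here _)      = contradiction refl ne
        first-edge ne (step _ e′ _) = _ , e′
        In : Subset n → Fin n → Set
        In T c = ∀ {r} → π r ≡ π c → r ∈ T
        freeᴸ : π a ≡ π t ⊎ In R a → π b ≡ π t ⊎ In R b → ∀ {q} → Pole q → q ∈ L → π q ≡ π t
        freeᴸ (inj₁ at) _         (inj₁ eq) _   = trans eq at
        freeᴸ (inj₂ aR) _         (inj₁ eq) q∈L = contradiction (aR eq) (L∩R q∈L)
        freeᴸ _         (inj₁ bt) (inj₂ eq) _   = trans eq bt
        freeᴸ _         (inj₂ bR) (inj₂ eq) q∈L = contradiction (bR eq) (L∩R q∈L)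
        freeᴿ : π a ≡ π t ⊎ In L a → π b ≡ π t ⊎ In L b → ∀ {q} → Pole q → q ∈ R → π q ≡ π t
        freeᴿ (inj₁ at) _         (inj₁ eq) _   = trans eq at
        freeᴿ (inj₂ aL) _         (inj₁ eq) q∈R = contradiction q∈R (L∩R (aL eq))
        freeᴿ _         (inj₁ bt) (inj₂ eq) _   = trans eq bt
        freeᴿ _         (inj₂ bL) (inj₂ eq) q∈R = contradiction q∈R (L∩R (bL eq))
        ≢tᴸ : ∀ {c} → In L c → π c ≢ π t
        ≢tᴸ cL eq = t∉L (cL (sym eq))
        ≢tᴿ : ∀ {c} → In R c → π c ≢ π t
        ≢tᴿ cR eq = t∉R (cR (sym eq))
        decide : π a ≡ π t ⊎ In L a ⊎ In R a → π b ≡ π t ⊎ In L b ⊎ In R b → x ∈ I ⊎ z ∈ I →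
                 Private x z ⊎ Private z x
        decide (inj₁ at)        (inj₁ bt)        _ = inj₁ (X.private-of-free-side x-in (freeᴸ (inj₁ at) (inj₁ bt)))
        decide (inj₁ at)        (inj₂ (inj₂ bR)) _ = inj₁ (X.private-of-free-side x-in (freeᴸ (inj₁ at) (inj₂ bR)))
        decide (inj₂ (inj₂ aR)) (inj₁ bt)        _ = inj₁ (X.private-of-free-side x-in (freeᴸ (inj₂ aR) (inj₁ bt)))
        decide (inj₂ (inj₂ aR)) (inj₂ (inj₂ bR)) _ = inj₁ (X.private-of-free-side x-in (freeᴸ (inj₂ aR) (inj₂ bR)))
        decide (inj₁ at)        (inj₂ (inj₁ bL)) _ = inj₂ (Z.private-of-free-side z-in (freeᴿ (inj₁ at) (inj₂ bL)))
        decide (inj₂ (inj₁ aL)) (inj₁ bt)        _ = inj₂ (Z.private-of-free-side z-in (freeᴿ (inj₂ aL) (inj₁ bt)))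
        decide (inj₂ (inj₁ aL)) (inj₂ (inj₁ bL)) _ = inj₂ (Z.private-of-free-side z-in (freeᴿ (inj₂ aL) (inj₂ bL)))
        decide (inj₂ (inj₁ aL)) (inj₂ (inj₂ bR)) (inj₁ x∈I) =
          contradiction x∈I (X.no-crossing id a∉I linked (≢tᴸ aL) (aL refl) bR)
        decide (inj₂ (inj₁ aL)) (inj₂ (inj₂ bR)) (inj₂ z∈I) =
          contradiction z∈I (Z.no-crossing swap b∉I (reach-sym K-sym linked) (≢tᴿ bR) (bR refl) aL)
        decide (inj₂ (inj₂ aR)) (inj₂ (inj₁ bL)) (inj₁ x∈I) =
          contradiction x∈I (X.no-crossing swap b∉I (reach-sym K-sym linked) (≢tᴸ bL) (bL refl) aR)
        decide (inj₂ (inj₂ aR)) (inj₂ (inj₁ bL)) (inj₂ z∈I) =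
          contradiction z∈I (Z.no-crossing id a∉I linked (≢tᴿ aR) (aR refl) bL)

      -- Counting arrows.

      Arrow : Fin n → Fin n → Set
      Arrow g h = Σ (Fin n) λ x → Σ (Fin n) λ z →
        π x ≡ g × π z ≡ h × Inside x × Inside z × K x z × π x ≢ π z × Private x z

      -- Two arrows leaving the two ends of a fibre would leave it only two neighbours,
      -- and of a pole only the end that is not on the link can carry one.
      arrow-functional : ∀ {g h₁ h₂} → Arrow g h₁ → Arrow g h₂ → h₁ ≡ h₂
      arrow-functional (x , z , refl , refl , x-in , z-in , e , ne , only , x≢a , x≢b)
                       (x′ , z′ , eq , refl , x′-in , z′-in , e′ , ne′ , only′ , x′≢a , x′≢b)
        with π-fibre (sym eq)
      ... | inj₁ refl with only z′-in e′
      ...   | inj₁ refl = contradiction (sym (π-mate x)) ne′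
      ...   | inj₂ refl = refl
      arrow-functional (x , z , refl , refl , inj₁ x∈I , z-in , e , ne , only , x≢a , x≢b)
                       (x′ , z′ , eq , refl , x′-in , z′-in , e′ , ne′ , only′ , x′≢a , x′≢b)
          | inj₂ refl with neighbour-avoiding (degree x∈I) (π z) (π z′)
      ... | g , (πx≢g , p , q , πp≡πx , refl , Kpq) , g≢z , g≢z′ with closed (fibre x∈I (sym πp≡πx)) Kpq | π-fibre (sym πp≡πx)
      ...   | q-in | inj₁ refl with only q-in Kpq
      ...     | inj₁ refl = contradiction (sym (π-mate x)) πx≢g
      ...     | inj₂ refl = contradiction refl g≢z
      arrow-functional (x , z , refl , refl , inj₁ x∈I , z-in , e , ne , only , x≢a , x≢b)
                       (x′ , z′ , eq , refl , x′-in , z′-in , e′ , ne′ , only′ , x′≢a , x′≢b)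
          | inj₂ refl | g , (πx≢g , p , q , πp≡πx , refl , Kpq) , g≢z , g≢z′ | q-in | inj₂ refl with only′ q-in Kpq
      ...     | inj₁ refl = contradiction (sym (trans (π-mate (mate x)) (π-mate x))) πx≢g
      ...     | inj₂ refl = contradiction refl g≢z′
      arrow-functional (x , z , refl , refl , inj₂ (inj₁ πx≡πa) , z-in , e , ne , only , x≢a , x≢b)
                       (x′ , z′ , eq , refl , x′-in , z′-in , e′ , ne′ , only′ , x′≢a , x′≢b)
          | inj₂ refl with π-fibre πx≡πa
      ... | inj₁ a≡x = contradiction (sym a≡x) x≢a
      ... | inj₂ a≡m = contradiction (sym a≡m) x′≢a
      arrow-functional (x , z , refl , refl , inj₂ (inj₂ πx≡πb) , z-in , e , ne , only , x≢a , x≢b)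
                       (x′ , z′ , eq , refl , x′-in , z′-in , e′ , ne′ , only′ , x′≢a , x′≢b)
          | inj₂ refl with π-fibre πx≡πb
      ... | inj₁ b≡x = contradiction (sym b≡x) x≢b
      ... | inj₂ b≡m = contradiction (sym b≡m) x′≢b

      orient : ∀ {r s} → r ∈ I → K r s → π r ≢ π s → Arrow (π r) (π s) ⊎ Arrow (π s) (π r)
      orient {r} {s} r∈ e ne with edge-private (inj₁ r∈) (closed r∈ e) e ne (inj₁ r∈)
      ... | inj₁ pr = inj₁ (r , s , refl , refl , inj₁ r∈ , closed r∈ e , e , ne , pr)
      ... | inj₂ pr = inj₂ (s , r , refl , refl , closed r∈ e , inj₁ r∈ , K-sym e , ne ∘ sym , pr)

      -- Each of three neighbouring fibres gives an arrow one way or the other, and at most one of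
      -- these arrows is outgoing.
      incoming-interior : ∀ {p} → p ∈ I → ∃ λ g → ∃ λ h → g ≢ h × Arrow g (π p) × Arrow h (π p)
      incoming-interior {p} p∈ with degree p∈
      ... | g₁ , g₂ , g₃ , e₁ , e₂ , e₃ , g₁≢g₂ , g₁≢g₃ , g₂≢g₃ = pick (oriented e₁) (oriented e₂) (oriented e₃)
        where
        oriented : ∀ {g} → Adjacent (π p) g → Arrow (π p) g ⊎ Arrow g (π p)
        oriented (ne , r , s , πr≡πp , refl , e) =
          subst (λ h → Arrow h (π s) ⊎ Arrow (π s) h) πr≡πp
            (orient (fibre p∈ (sym πr≡πp)) e (ne ∘ trans (sym πr≡πp)))
        pick : Arrow (π p) g₁ ⊎ Arrow g₁ (π p) → Arrow (π p) g₂ ⊎ Arrow g₂ (π p) → Arrow (π p) g₃ ⊎ Arrow g₃ (π p) →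
               ∃ λ g → ∃ λ h → g ≢ h × Arrow g (π p) × Arrow h (π p)
        pick (inj₂ i₁) (inj₂ i₂) _         = g₁ , g₂ , g₁≢g₂ , i₁ , i₂
        pick (inj₂ i₁) (inj₁ _)  (inj₂ i₃) = g₁ , g₃ , g₁≢g₃ , i₁ , i₃
        pick (inj₁ _)  (inj₂ i₂) (inj₂ i₃) = g₂ , g₃ , g₂≢g₃ , i₂ , i₃
        pick (inj₁ o₁) (inj₁ o₂) _         = contradiction (arrow-functional o₁ o₂) g₁≢g₂
        pick (inj₁ o₁) (inj₂ _)  (inj₁ o₃) = contradiction (arrow-functional o₁ o₃) g₁≢g₃
        pick (inj₂ _)  (inj₁ o₂) (inj₁ o₃) = contradiction (arrow-functional o₂ o₃) g₂≢g₃

      -- Two fibres of `I` are joined to the pole by arrows, and only one of these can leave the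
      -- pole.
      incoming-pole : ∀ {c d} → Pole c → Cap I c d → ∃ λ g → Arrow g (π c)
      incoming-pole {c} pole D with pole-two-neighbours D
      ... | r₁ , s₁ , r₂ , s₂ , (r₁∈ , e₁ , eq₁) , (r₂∈ , e₂ , eq₂) , ne =
        pick (oriented r₁∈ e₁ eq₁) (oriented r₂∈ e₂ eq₂)
        where
        oriented : ∀ {r s} → r ∈ I → K r s → π s ≡ π c → Arrow (π r) (π c) ⊎ Arrow (π c) (π r)
        oriented {r} r∈ e eq = subst (λ h → Arrow (π r) h ⊎ Arrow h (π r)) eq
          (orient r∈ e λ πr≡πs → pole∉I pole (fibre r∈ (trans πr≡πs eq)))
        pick : Arrow (π r₁) (π c) ⊎ Arrow (π c) (π r₁) → Arrow (π r₂) (π c) ⊎ Arrow (π c) (π r₂) → ∃ λ g → Arrow g (π c)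
        pick (inj₁ i₁) _         = _ , i₁
        pick (inj₂ _)  (inj₁ i₂) = _ , i₂
        pick (inj₂ o₁) (inj₂ o₂) = contradiction (arrow-functional o₁ o₂) ne

      Node : Fin n → Set
      Node h = ∃ λ p → Inside p × π p ≡ h

      node? : Decidable Node
      node? h = any? (λ p → ((p ∈? I) ⊎-dec ((π p ≟ π a) ⊎-dec (π p ≟ π b))) ×-dec (π p ≟ h))

      incoming : ∀ {h} → Node h → ∃ λ g → Arrow g h
      incoming (p , inj₁ p∈ , refl) = let g , _ , _ , i , _ = incoming-interior p∈ in g , i
      incoming (p , inj₂ (inj₁ eq) , refl) =
        subst (λ h → ∃ λ g → Arrow g h) (sym eq) (incoming-pole (inj₁ refl) C)
      incoming (p , inj₂ (inj₂ eq) , refl) =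
        subst (λ h → ∃ λ g → Arrow g h) (sym eq) (incoming-pole (inj₂ refl) (cap-sym C))

      arrow-source : ∀ {g h} → Arrow g h → Node g
      arrow-source (x , _ , eq , _ , x-in , _) = x , x-in , eq

      -- Choosing an incoming arrow at every node is injective, hence onto, so no node has two.
      no-cap-two-poles : ⊥
      no-cap-two-poles with nonempty
      ... | p , p∈ with incoming-interior p∈
      ... | g , h , g≢h , i , j = g≢h (trans (sym (only-source i)) (only-source j))
        where
        source : Fin n → Fin n
        -- Non-nodes are fixed to make the map total on a finite set. Sources of nodes are again
        -- nodes, so the two cases cannot collide.
        source k with node? k
        ... | yes node = proj₁ (incoming node)
        ... | no _     = k
        source-arrow : ∀ {k} → Node k → Arrow (source k) k
        source-arrow {k} node with node? k
        ... | yes node′ = proj₂ (incoming node′)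
        ... | no ¬node  = contradiction node ¬node
        source-fixed : ∀ {k} → ¬ Node k → source k ≡ k
        source-fixed {k} ¬node with node? k
        ... | yes node = contradiction node ¬node
        ... | no _     = refl
        node-of-source : ∀ {k} → Node (source k) → Node k
        node-of-source {k} node with node? k
        ... | yes node′ = node′
        ... | no ¬node  = node
        source-injective : ∀ {k l} → source k ≡ source l → k ≡ l
        source-injective {k} {l} eq = compare (node? k) (node? l)
          where
          compare : Dec (Node k) → Dec (Node l) → k ≡ l
          compare (yes nk) (yes nl) = arrow-functional (source-arrow nk) (subst (λ m → Arrow m l) (sym eq) (source-arrow nl))
          compare (no ¬nk) (no ¬nl) = trans (sym (source-fixed ¬nk)) (trans eq (source-fixed ¬nl))
          compare (yes nk) (no ¬nl) = contradiction (node-of-source (subst Node eq (arrow-source (source-arrow nk)))) ¬nl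
          compare (no ¬nk) (yes nl) = contradiction (node-of-source (subst Node (sym eq) (arrow-source (source-arrow nl)))) ¬nk
        only-source : ∀ {g} → Arrow g (π p) → source (π p) ≡ g
        only-source {g} i with injective⇒surjective source source-injective g
        ... | k , refl = cong source (arrow-functional i (source-arrow (node-of-source (arrow-source i))))

    -- For distinct poles the link is trimmed from both ends: first at its first hit of the fibre of
    -- `a`, then, reversed, at its first hit of the fibre of `b`. The ends reached become the poles.
    no-cap : ∀ {a b} → ¬ Cap I a b
    no-cap {a} {b} C with π a ≟ π b
    ... | yes eq = no-cap-one-pole {a} (record
            { nonempty = nonempty ; saturated = saturated ; degree = degree
            ; closed = λ p∈ e → [ inj₁ , [ inj₂ ∘ inj₁ , (λ eq′ → inj₂ (inj₁ (trans eq′ (sym eq)))) ]′ ]′ (closed p∈ e)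
            ; a∉I = a∉I ; b∉I = a∉I ; linked = here a∉I })
      where open Cap C
    ... | no ne
      with reach-firstHit (λ p → π p ≟ π a) (reach-sym K-sym (Cap.linked C)) refl
    ... | a₁ , πa₁ , r with reach-firstHit (λ p → π p ≟ π b) (reach-sym K-sym r) refl
    ... | b₁ , πb₁ , r′ = TwoPoles.no-cap-two-poles C₁ (λ eq → ne (trans (sym πa₁) (trans eq πb₁)))
            (reach-weaken (λ { ((p∉ , f) , g) → p∉ , (λ eq → f (trans eq πa₁)) , (λ eq → g (trans eq πb₁)) }) r′)
      where
      open Cap C
      C₁ : Cap I a₁ b₁
      C₁ = record
        { nonempty = nonempty ; saturated = saturated ; degree = degree
        ; closed = λ p∈ e → [ inj₁ , [ (λ eq → inj₂ (inj₁ (trans eq (sym πa₁)))) , (λ eq → inj₂ (inj₂ (trans eq (sym πb₁)))) ]′ ]′ (closed p∈ e)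
        ; a∉I = λ a₁∈ → a∉I (fibre a₁∈ πa₁) ; b∉I = λ b₁∈ → b∉I (fibre b₁∈ πb₁)
        ; linked = reach-weaken (proj₁ ∘ proj₁) r′ }

  no-cap : (∀ {x z} → K x z → π x ≢ π z → Separation x z) → ∀ {I a b} → ¬ Cap I a b
  no-cap sep {I} = go I (⊂-wellFounded I)
    where
    go : ∀ I → Acc _⊂_ I → ∀ {a b} → ¬ Cap I a b
    go I (acc rec) = MinimalCap.no-cap sep I λ I′⊂I → go _ (rec I′⊂I)

-- Degrees as numbers of listed neighbours.

sum-indicator : {X : Set} (f : X → Bool) (xs : List X) →
                sum (map (λ x → if f x then 1 else 0) xs) ≡ length (filter (λ x → f x ≟ᵇ true) xs)
sum-indicator f []       = refl
sum-indicator f (x ∷ xs) with f x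
... | true  = cong suc (sum-indicator f xs)
... | false = sum-indicator f xs

three-distinct : {X : Set} {P : X → Set} (xs : List X) → Unique xs → All P xs → 3 ≤ length xs →
                 Σ X λ x → Σ X λ y → Σ X λ z → P x × P y × P z × x ≢ y × x ≢ z × y ≢ z
three-distinct (x ∷ y ∷ z ∷ _) ((x≢y ∷ x≢z ∷ _) ∷ (y≢z ∷ _) ∷ _) (px ∷ py ∷ pz ∷ _) _ =
  x , y , z , px , py , pz , x≢y , x≢z , y≢z
three-distinct []            _ _ ()
three-distinct (_ ∷ [])      _ _ (s≤s ())
three-distinct (_ ∷ _ ∷ [])  _ _ (s≤s (s≤s ()))

-- The pairing given by a matching.

module MatchedPairs {n : ℕ} (G : Graph n) (M : Matching G) where

  covered? : Decidable (Covered G M)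
  covered? v = any? (λ u → medge M v u ≟ᵇ true)

  -- Uncovered vertices are their own mates, so that this is an involution on all vertices.
  mate : Fin n → Fin n
  mate v with covered? v
  ... | yes (u , _) = u
  ... | no _        = v

  medge-mate : ∀ {v} → Covered G M v → medge M v (mate v) ≡ true
  medge-mate {v} c with covered? v
  ... | yes (_ , m) = m
  ... | no ¬c       = contradiction c ¬c

  mate-unique : ∀ {v u} → medge M v u ≡ true → mate v ≡ u
  mate-unique m = medge-uniq M _ _ _ (medge-mate (_ , m)) m

  mate-uncovered : ∀ {v} → ¬ Covered G M v → mate v ≡ v
  mate-uncovered {v} ¬c with covered? v
  ... | yes c = contradiction c ¬c
  ... | no _  = refl

  mate-involutive : ∀ v → mate (mate v) ≡ v
  mate-involutive v with covered? v
  ... | yes (u , m) = mate-unique (trans (medge-sym M u v) m)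
  ... | no ¬c       = mate-uncovered ¬c

  -- On covered vertices this is the contraction map: it picks the end of smaller index, the
  -- representative used by `VGM`.
  π : Fin n → Fin n
  π v with toℕ v <? toℕ (mate v)
  ... | yes _ = v
  ... | no _  = mate v

  π-< : ∀ {v} → toℕ v < toℕ (mate v) → π v ≡ v
  π-< {v} lt with toℕ v <? toℕ (mate v)
  ... | yes _  = refl
  ... | no ¬lt = contradiction lt ¬lt

  π-≮ : ∀ {v} → ¬ toℕ v < toℕ (mate v) → π v ≡ mate v
  π-≮ {v} ¬lt with toℕ v <? toℕ (mate v)
  ... | yes lt = contradiction lt ¬lt
  ... | no _   = refl

  π-cases : ∀ v → π v ≡ v ⊎ π v ≡ mate v
  π-cases v with toℕ v <? toℕ (mate v)
  ... | yes _ = inj₁ refl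
  ... | no _  = inj₂ refl

  π-mate : ∀ v → π (mate v) ≡ π v
  π-mate v = compare (toℕ v <? toℕ m) (toℕ m <? toℕ v)
    where
    m = mate v
    <m : toℕ m < toℕ v → toℕ m < toℕ (mate m)
    <m = subst (λ w → toℕ m < toℕ w) (sym (mate-involutive v))
    ≮m : ¬ toℕ m < toℕ v → ¬ toℕ m < toℕ (mate m)
    ≮m ≮v = ≮v ∘ subst (λ w → toℕ m < toℕ w) (mate-involutive v)
    compare : Dec (toℕ v < toℕ m) → Dec (toℕ m < toℕ v) → π m ≡ π v
    compare (yes v<m) (yes m<v) = contradiction m<v (<-asym v<m)
    compare (yes v<m) (no m≮v)  = trans (π-≮ (≮m m≮v)) (trans (mate-involutive v) (sym (π-< v<m)))
    compare (no v≮m)  (yes m<v) = trans (π-< (<m m<v)) (sym (π-≮ v≮m))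
    -- Both inequalities fail only when `v` is its own mate.
    compare (no v≮m)  (no m≮v)  = cong π (toℕ-injective (≤-antisym (≮⇒≥ v≮m) (≮⇒≥ m≮v)))

  π-fibre : ∀ {p q} → π p ≡ π q → q ≡ p ⊎ q ≡ mate p
  π-fibre {p} {q} eq with π-cases p | π-cases q
  ... | inj₁ p′ | inj₁ q′ = inj₁ (trans (sym q′) (trans (sym eq) p′))
  ... | inj₁ p′ | inj₂ q′ = inj₂ (trans (sym (mate-involutive q)) (cong mate (trans (sym q′) (trans (sym eq) p′))))
  ... | inj₂ p′ | inj₁ q′ = inj₂ (trans (sym q′) (trans (sym eq) p′))
  ... | inj₂ p′ | inj₂ q′ = inj₁ (trans (sym (mate-involutive q))
          (trans (cong mate (trans (sym q′) (trans (sym eq) p′))) (mate-involutive p)))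

  π-VGM : ∀ {x} → VGM G M x → π x ≡ x
  π-VGM (y , m , x<y) = π-< (subst (λ w → _ < toℕ w) (sym (mate-unique m)) x<y)

  π-EndOf : ∀ {x x′} → VGM G M x → EndOf G M x x′ → π x′ ≡ x
  π-EndOf vx (inj₁ refl) = π-VGM vx
  π-EndOf {x} vx (inj₂ m) = trans (cong π (sym (mate-unique m))) (trans (π-mate x) (π-VGM vx))

  -- An uncovered `p` would be its own representative, and `VGM` would then give it a matching edge.
  covered-π : ∀ {p} → VGM G M (π p) → Covered G M p
  covered-π {p} (y , m , _) = decidable-stable (covered? p) λ ¬c →
    ¬c (y , subst (λ w → medge M w y ≡ true) ([ id , (λ eq → trans eq (mate-uncovered ¬c)) ]′ (π-cases p)) m)

-- Lifting a subgraph of the contracted graph, and the conclusion.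

module _ {n : ℕ} (G : Graph n) (M : Matching G) (H : SubgraphGM G M) where
  open MatchedPairs G M

  Lifted : Fin n → Fin n → Set
  Lifted p q = (hv H (π p) ≡ true × medge M p q ≡ true) ⊎ (he H (π p) (π q) ≡ true × E G M p q)

  medge-π : ∀ {p q} → medge M p q ≡ true → π q ≡ π p
  medge-π {p} m = trans (cong π (sym (mate-unique m))) (π-mate p)

  lifted⇒edge : ∀ {p q} → Lifted p q → E G M p q
  lifted⇒edge (inj₁ (_ , m)) = medge-adj M _ _ m
  lifted⇒edge (inj₂ (_ , e)) = e

  lifted-hv : ∀ {p q} → Lifted p q → hv H (π p) ≡ true
  lifted-hv (inj₁ (h , _)) = h
  lifted-hv (inj₂ (e , _)) = proj₁ (proj₂ (he-sub H _ _ e))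

  lifted-sym : ∀ {p q} → Lifted p q → Lifted q p
  lifted-sym {p} {q} (inj₁ (h , m)) =
    inj₁ (subst (λ v → hv H v ≡ true) (sym (medge-π m)) h , trans (medge-sym M q p) m)
  lifted-sym {p} {q} (inj₂ (h , e)) = inj₂ (trans (he-sym H _ _) h , trans (adj-sym G q p) e)

  lifted-covered : ∀ {p q} → Lifted p q → Covered G M p
  lifted-covered e = covered-π (hv-sub H _ (lifted-hv e))

  lift : PairedGraph n
  lift = record
    { K = Lifted
    ; K? = λ p q → ((hv H (π p) ≟ᵇ true) ×-dec (medge M p q ≟ᵇ true))
                   ⊎-dec ((he H (π p) (π q) ≟ᵇ true) ×-dec (adj G p q ≟ᵇ true))
    ; K-sym = lifted-sym
    ; K-irr = λ {p} e → contradiction (trans (sym (lifted⇒edge e)) (adj-irr G p)) λ ()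
    ; mate = mate ; π = π ; mate-inv = mate-involutive ; π-mate = π-mate ; π-fibre = π-fibre
    ; K-mate = λ e → inj₁ (lifted-hv e , medge-mate (lifted-covered e)) }

  open Separations lift
  open Caps lift

  -- The ends of a matching edge share a fibre, so an edge between distinct fibres is outside `M`.
  -- Property (ii) then forbids the cycle that is the alternative to a separation.
  lift-separation : PropertyP G M → ∀ {x z} → Lifted x z → π x ≢ π z → Separation x z
  lift-separation (_ , chordless) {x} {z} e πx≢πz with cycle⊎separation e πx≢πz
  ... | inj₂ S = S
  ... | inj₁ (vs , (unique , long , linked) , x∈) = ⊥-elim
    (chordless x z (lifted⇒edge e) (¬-not λ m → πx≢πz (sym (medge-π m)))
      (lifted-covered e) (lifted-covered (lifted-sym e))
      (z , vs , (unique , long , Linked.map (λ { (k , ne) → lifted⇒edge k , ne }) linked) , x∈ , here refl))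

  he-adjacent : ∀ {x y} → he H x y ≡ true → Adjacent x y
  he-adjacent {x} {y} h with he-sub H x y h
  ... | (vx , vy , x≢y , x′ , y′ , end , end′ , e) , _ =
    x≢y , x′ , y′ , π-EndOf vx end , π-EndOf vy end′ ,
    inj₂ (subst₂ (λ v w → he H v w ≡ true) (sym (π-EndOf vx end)) (sym (π-EndOf vy end′)) h , e)

  degree⇒neighbours : ∀ {x} → 3 ≤ degH G M H x → ThreeNeighbours x
  degree⇒neighbours {x} 3≤d =
    let y₁ , y₂ , y₃ , h₁ , h₂ , h₃ , distinct = three-distinct _
          (Unique.filter⁺ he? (Unique.allFin⁺ n)) (all-filter he? (allFin n))
          (subst (3 ≤_) (sum-indicator (he H x) (allFin n)) 3≤d)
    in  y₁ , y₂ , y₃ , he-adjacent h₁ , he-adjacent h₂ , he-adjacent h₃ , distinct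
    where
    he? : Decidable (λ y → he H x y ≡ true)
    he? y = he H x y ≟ᵇ true

  -- The fibres of all vertices of `H` except `r` would form a cap with `r` as both poles, since an
  -- edge of `K` leaving them can only end in the fibre of `r`. The vertex `v` makes it nonempty.
  no-large-rest : PropertyP G M → ∀ {r v} → hv H r ≡ true → hv H v ≡ true → v ≢ r →
                  ¬ (∀ w → hv H w ≡ true → w ≢ r → 3 ≤ degH G M H w)
  no-large-rest P {r} {v} hr hv-v v≢r large = no-cap (lift-separation P) {⟪ rest? ⟫} {r} {r} (record
    { nonempty = v , ⁺ (subst (λ w → hv H w ≡ true × w ≢ r) (sym (π-VGM (hv-sub H v hv-v))) (hv-v , v≢r))
    ; saturated = λ {p} p∈ → ⁺ (subst (λ w → hv H w ≡ true × w ≢ r) (sym (π-mate p)) (⁻ p∈))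
    ; degree = λ p∈ → degree⇒neighbours (large _ (proj₁ (⁻ p∈)) (proj₂ (⁻ p∈)))
    ; closed = λ _ → closed ; a∉I = r∉ ; b∉I = r∉ ; linked = here r∉ })
    where
    Rest : Fin n → Set
    Rest p = hv H (π p) ≡ true × π p ≢ r
    rest? : Decidable Rest
    rest? p = (hv H (π p) ≟ᵇ true) ×-dec ¬? (π p ≟ r)
    ⁺ : ∀ {p} → Rest p → p ∈ ⟪ rest? ⟫
    ⁺ = ∈⟪⟫⁺ rest?
    ⁻ : ∀ {p} → p ∈ ⟪ rest? ⟫ → Rest p
    ⁻ = ∈⟪⟫⁻ rest?
    πr≡r : π r ≡ r
    πr≡r = π-VGM (hv-sub H r hr)
    r∉ : r ∉ ⟪ rest? ⟫
    r∉ r∈ = proj₂ (⁻ r∈) πr≡r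
    closed : ∀ {p q} → Lifted p q → q ∈ ⟪ rest? ⟫ ⊎ π q ≡ π r ⊎ π q ≡ π r
    closed {q = q} e with π q ≟ r
    ... | yes eq = inj₂ (inj₁ (trans eq (sym πr≡r)))
    ... | no ne  = inj₁ (⁺ (lifted-hv (lifted-sym e) , ne))

theorem3 : (n : ℕ) (G : Graph n) (M : Matching G) → PropertyP G M →
    (H : SubgraphGM G M) →
    (Σ (Fin n) λ u → Σ (Fin n) λ v → u ≢ v × hv H u ≡ true × hv H v ≡ true) →
    Σ (Fin n) λ u → Σ (Fin n) λ v → u ≢ v × hv H u ≡ true × hv H v ≡ true ×
    degH G M H u ≤ 2 × degH G M H v ≤ 2
theorem3 n G M P H (u₀ , v₀ , u₀≢v₀ , hu₀ , hv₀)
  with any? (λ u → (hv H u ≟ᵇ true) ×-dec (degH G M H u ≤? 2))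
-- With no vertex of small degree at all, `u₀` plays the exceptional vertex.
... | no none = ⊥-elim (no-large-rest G M H P hu₀ hv₀ (u₀≢v₀ ∘ sym)
        λ w hw _ → ≰⇒> λ d≤2 → none (w , hw , d≤2))
... | yes (u , hu , du)
  with any? (λ v → ¬? (u ≟ v) ×-dec ((hv H v ≟ᵇ true) ×-dec (degH G M H v ≤? 2)))
... | yes (v , u≢v , hv-v , dv) = u , v , u≢v , hu , hv-v , du , dv
-- Now `u` is the exceptional vertex, and one of `u₀` and `v₀` differs from it.
... | no none = ⊥-elim (other (u₀ ≟ u))
  where
  large : ∀ w → hv H w ≡ true → w ≢ u → 3 ≤ degH G M H w
  large w hw w≢u = ≰⇒> λ d≤2 → none (w , w≢u ∘ sym , hw , d≤2)
  other : Dec (u₀ ≡ u) → ⊥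
  other (yes refl) = no-large-rest G M H P hu hv₀ (u₀≢v₀ ∘ sym) large
  other (no u₀≢u)  = no-large-rest G M H P hu hu₀ u₀≢u large
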